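{- Over $\mathrm{HA}^\omega+\mathrm{BI}+\mathrm{CONT}$, the dependent implicitly controlled product of selection functions $\mathsf{IPS}$ is $T$-definable from the dependent iterated skewed product (modified bar recursion) $\mathsf{MBR}$; that is, $\mathsf{MBR}\geq_T\mathsf{IPS}$. Here both functionals are considered for sequences over a single fixed type ($X_i=X$ for all $i$), with $R$ discrete.
   Context: Types and systems. Finite types are generated from $\mathbb{B}$ (booleans) and $\mathbb{N}$ by $X\times Y$, $X\to Y$ and $X^*$ (finite sequences); $X^{\mathbb{N}}$ is $\mathbb{N}\to X$. $\mathrm{HA}^\omega$ is Heyting arithmetic in all finite types with fully extensional equality (Troelstra's E-$\mathrm{HA}^\omega$); system $T$ is its quantifier-free fragment (Gödel's primitive recursive functionals). Notation. $*$ is concatenation; $q_x(\alpha)=q(x*\alpha)$; $[\alpha](n)=\langle\alpha(0),\dots,\alpha(n-1)\rangle$. $J_RX=(X\to R)\to X$. $T$-definability. A functional is specified by a defining equation (for each choice of type parameters). $G$ is $T$-definable from $F$ over a theory $\mathcal{S}$ (written $F\ge_T G$) if for each choice of types for $G$ there are a choice of types for $F$ and a term $s$ of system $T$ such that $s(F)$ satisfies the defining equation of $G$, provably in $\mathcal{S}$ together with the defining equation of $F$. $\mathsf{IPS}$ (types $X,R$). For $\varepsilon\colon X^*\to J_RX$, $s\colon X^*$ and $q\colon X^{\mathbb{N}}\to R$, $\mathsf{IPS}_s(\varepsilon)(q)\colon X^{\mathbb{N}}$ is specified by $\mathsf{IPS}_s(\varepsilon)(q)=c*\mathsf{IPS}_{s*c}(\varepsilon)(q_c)$,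 where $c=\varepsilon_s(\lambda x.\,q_x(\mathsf{IPS}_{s*x}(\varepsilon)(q_x)))$. $\mathsf{MBR}$ (types $Y,R$). For $\nu_s\colon(Y\to R)\to Y^{\mathbb{N}}$ ($s\colon Y^*$) and $q\colon Y^{\mathbb{N}}\to R$, $\mathsf{MBR}_s(\nu)(q)\colon Y^{\mathbb{N}}$ is specified by $\mathsf{MBR}_s(\nu)(q)=\nu_s(\lambda y.\,q_y(\mathsf{MBR}_{s*y}(\nu)(q_y)))$. $\mathrm{CONT}$: for discrete $R$, $\forall q^{X^{\mathbb{N}}\to R}\,\forall\alpha\,\exists n\,\forall\beta\,([\alpha](n)=[\beta](n)\to q(\alpha)=q(\beta))$. Discrete and compact types are generated by: compact $::=\mathbb{B}\mid$ compact $\times$ compact $\mid$ discrete $\to$ compact; discrete $::=\mathbb{B}\mid\mathbb{N}\mid$ discrete $\times$ discrete $\mid$ discrete$^*$ $\mid$ compact $\to$ discrete. $\mathrm{BI}$ (relativised bar induction) is the scheme, for arbitrary predicates $S,P$ on finite sequences: if $S(\langle\rangle)$, and for every infinite $\alpha$ with $S([\alpha](n))$ for all $n$ there is $n$ with $P([\alpha](n))$, and for all $s$ with $S(s)$: $\forall x[S(s*x)\to P(s*x)]\to P(s)$; then $P(\langle\rangle)$. -}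

module Defs where

open import Data.List.Base using (List; []; _∷_; map)
open import Data.List.Membership.Propositional using (_∈_)
open import Data.List.Relation.Unary.Any using (here; there)
open import Data.Product.Base using (Σ-syntax)
open import Function.Base using (_∘_)
open import Level using (0ℓ)
open import Relation.Binary.PropositionalEquality using (refl)
open import Relation.Unary using (Pred; _∪_)

infixr 25 _⇒_
infixr 27 _⊗_
infix  30 _✶ _^ℕ
infixl 20 _·_
infix  12 _≐_
infixr 10 _∧̇_
infixr 9  _∨̇_
infixr 8  _⊃_
infixr 8  ∀̇[_]_ ∃̇[_]_
infixl 5  _▹_
infix  4  _⨾_⊢_ _≥T[_]_
infixr 6  _⊕_

data Ty : Set where
  𝔹 ℕ : Ty
  _⊗_ : Ty → Ty → Ty
  _⇒_ : Ty → Ty → Ty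
  _✶  : Ty → Ty

_^ℕ : Ty → Ty
X ^ℕ = ℕ ⇒ X

J : Ty → Ty → Ty
J R X = (X ⇒ R) ⇒ X

mutual
  data Compact : Ty → Set where
    𝔹   : Compact 𝔹
    _⊗_ : ∀ {A B} → Compact A → Compact B → Compact (A ⊗ B)
    _⇒_ : ∀ {A B} → Discrete A → Compact B → Compact (A ⇒ B)

  data Discrete : Ty → Set where
    𝔹   : Discrete 𝔹
    ℕ   : Discrete ℕ
    _⊗_ : ∀ {A B} → Discrete A → Discrete B → Discrete (A ⊗ B)
    _✶  : ∀ {A} → Discrete A → Discrete (A ✶)
    _⇒_ : ∀ {A B} → Compact A → Discrete B → Discrete (A ⇒ B)

Ctx : Set
Ctx = List Ty

data Const : Ty → Set where
  tt ff   : Const 𝔹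
  cond    : ∀ {A} → Const (𝔹 ⇒ A ⇒ A ⇒ A)
  zero    : Const ℕ
  suc     : Const (ℕ ⇒ ℕ)
  natrec  : ∀ {A} → Const (A ⇒ (ℕ ⇒ A ⇒ A) ⇒ ℕ ⇒ A)
  pair    : ∀ {A B} → Const (A ⇒ B ⇒ A ⊗ B)
  fst     : ∀ {A B} → Const (A ⊗ B ⇒ A)
  snd     : ∀ {A B} → Const (A ⊗ B ⇒ B)
  nil     : ∀ {A} → Const (A ✶)
  cons    : ∀ {A} → Const (A ⇒ A ✶ ⇒ A ✶)
  listrec : ∀ {A B} → Const (B ⇒ (A ⇒ A ✶ ⇒ B ⇒ B) ⇒ A ✶ ⇒ B)

data Tm (Γ : Ctx) : Ty → Set where
  var : ∀ {A} → A ∈ Γ → Tm Γ A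
  con : ∀ {A} → Const A → Tm Γ A
  ƛ   : ∀ {A B} → Tm (A ∷ Γ) B → Tm Γ (A ⇒ B)
  _·_ : ∀ {A B} → Tm Γ (A ⇒ B) → Tm Γ A → Tm Γ B

Ren : Ctx → Ctx → Set
Ren Γ Δ = ∀ {A} → A ∈ Γ → A ∈ Δ

Sub : Ctx → Ctx → Set
Sub Γ Δ = ∀ {A} → A ∈ Γ → Tm Δ A

liftᴿ : ∀ {Γ Δ A} → Ren Γ Δ → Ren (A ∷ Γ) (A ∷ Δ)
liftᴿ ρ (here p)  = here p
liftᴿ ρ (there x) = there (ρ x)

ren : ∀ {Γ Δ A} → Ren Γ Δ → Tm Γ A → Tm Δ A
ren ρ (var x) = var (ρ x)
ren ρ (con k) = con k
ren ρ (ƛ t)   = ƛ (ren (liftᴿ ρ) t)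
ren ρ (t · u) = ren ρ t · ren ρ u

_▹_ : ∀ {Γ Δ A} → Sub Γ Δ → Tm Δ A → Sub (A ∷ Γ) Δ
(σ ▹ t) (here refl) = t
(σ ▹ t) (there x)   = σ x

liftˢ : ∀ {Γ Δ A} → Sub Γ Δ → Sub (A ∷ Γ) (A ∷ Δ)
liftˢ σ (here p)  = var (here p)
liftˢ σ (there x) = ren there (σ x)

sub : ∀ {Γ Δ A} → Sub Γ Δ → Tm Γ A → Tm Δ A
sub σ (var x) = σ x
sub σ (con k) = con k
sub σ (ƛ t)   = ƛ (sub (liftˢ σ) t)
sub σ (t · u) = sub σ t · sub σ u

_[_] : ∀ {Γ A B} → Tm (A ∷ Γ) B → Tm Γ A → Tm Γ B
t [ u ] = sub (var ▹ u) t

v0 : ∀ {Γ A} → Tm (A ∷ Γ) A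
v0 = var (here refl)

v1 : ∀ {Γ A B} → Tm (B ∷ A ∷ Γ) A
v1 = var (there (here refl))

v2 : ∀ {Γ A B C} → Tm (C ∷ B ∷ A ∷ Γ) A
v2 = var (there (there (here refl)))

v3 : ∀ {Γ A B C D} → Tm (D ∷ C ∷ B ∷ A ∷ Γ) A
v3 = var (there (there (there (here refl))))

v4 : ∀ {Γ A B C D E} → Tm (E ∷ D ∷ C ∷ B ∷ A ∷ Γ) A
v4 = var (there (there (there (there (here refl)))))

-- The sequence operations are closed terms, so substitution does not affect them.

-- s , t ↦ s * t
append : ∀ {Γ X} → Tm Γ (X ✶ ⇒ X ✶ ⇒ X ✶)
append = ƛ (ƛ (con listrec · v0 · ƛ (ƛ (ƛ (con cons · v2 · v0))) · v1))

-- s , x ↦ s * ⟨ x ⟩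
snoc : ∀ {Γ X} → Tm Γ (X ✶ ⇒ X ⇒ X ✶)
snoc = ƛ (ƛ (append · v1 · (con cons · v0 · con nil)))

-- x , α ↦ x * α
prefix : ∀ {Γ X} → Tm Γ (X ⇒ X ^ℕ ⇒ X ^ℕ)
prefix = ƛ (ƛ (ƛ (con natrec · v2 · ƛ (ƛ (v3 · v1)) · v0)))

-- q , x ↦ qₓ
shift : ∀ {Γ X R} → Tm Γ ((X ^ℕ ⇒ R) ⇒ X ⇒ X ^ℕ ⇒ R)
shift = ƛ (ƛ (ƛ (v2 · (prefix · v1 · v0))))

-- α , n ↦ [α](n)
initial : ∀ {Γ X} → Tm Γ (X ^ℕ ⇒ ℕ ⇒ X ✶)
initial = ƛ (ƛ (con natrec · con nil · ƛ (ƛ (snoc · v0 · (v3 · v1))) · v0))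

data Formula (Γ : Ctx) : Set where
  ⊥̇         : Formula Γ
  _≐_       : ∀ {A} → Tm Γ A → Tm Γ A → Formula Γ
  _∧̇_ _∨̇_ _⊃_ : Formula Γ → Formula Γ → Formula Γ
  ∀̇[_]_ ∃̇[_]_ : (A : Ty) → Formula (A ∷ Γ) → Formula Γ

renF : ∀ {Γ Δ} → Ren Γ Δ → Formula Γ → Formula Δ
renF ρ ⊥̇          = ⊥̇
renF ρ (t ≐ u)    = ren ρ t ≐ ren ρ u
renF ρ (φ ∧̇ ψ)    = renF ρ φ ∧̇ renF ρ ψ
renF ρ (φ ∨̇ ψ)    = renF ρ φ ∨̇ renF ρ ψ
renF ρ (φ ⊃ ψ)    = renF ρ φ ⊃ renF ρ ψ
renF ρ (∀̇[ A ] φ) = ∀̇[ A ] renF (liftᴿ ρ) φ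
renF ρ (∃̇[ A ] φ) = ∃̇[ A ] renF (liftᴿ ρ) φ

subF : ∀ {Γ Δ} → Sub Γ Δ → Formula Γ → Formula Δ
subF σ ⊥̇          = ⊥̇
subF σ (t ≐ u)    = sub σ t ≐ sub σ u
subF σ (φ ∧̇ ψ)    = subF σ φ ∧̇ subF σ ψ
subF σ (φ ∨̇ ψ)    = subF σ φ ∨̇ subF σ ψ
subF σ (φ ⊃ ψ)    = subF σ φ ⊃ subF σ ψ
subF σ (∀̇[ A ] φ) = ∀̇[ A ] subF (liftˢ σ) φ
subF σ (∃̇[ A ] φ) = ∃̇[ A ] subF (liftˢ σ) φ

_[_]F : ∀ {Γ A} → Formula (A ∷ Γ) → Tm Γ A → Formula Γ
φ [ t ]F = subF (var ▹ t) φ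

Theory : Set₁
Theory = (Γ : Ctx) → Pred (Formula Γ) 0ℓ

_⊕_ : Theory → Theory → Theory
(𝒯 ⊕ 𝒰) Γ = 𝒯 Γ ∪ 𝒰 Γ

-- Derivability in many-sorted intuitionistic logic with equality.
-- The axioms of a theory may have free variables, which act as arbitrary parameters.
data _⨾_⊢_ (𝒯 : Theory) {Γ : Ctx} (Φ : List (Formula Γ)) : Formula Γ → Set where
  axiom : ∀ {φ} → 𝒯 Γ φ → 𝒯 ⨾ Φ ⊢ φ
  hyp   : ∀ {φ} → φ ∈ Φ → 𝒯 ⨾ Φ ⊢ φ

  ⊥E  : ∀ {φ} → 𝒯 ⨾ Φ ⊢ ⊥̇ → 𝒯 ⨾ Φ ⊢ φ
  ∧I  : ∀ {φ ψ} → 𝒯 ⨾ Φ ⊢ φ → 𝒯 ⨾ Φ ⊢ ψ → 𝒯 ⨾ Φ ⊢ φ ∧̇ ψ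
  ∧E₁ : ∀ {φ ψ} → 𝒯 ⨾ Φ ⊢ φ ∧̇ ψ → 𝒯 ⨾ Φ ⊢ φ
  ∧E₂ : ∀ {φ ψ} → 𝒯 ⨾ Φ ⊢ φ ∧̇ ψ → 𝒯 ⨾ Φ ⊢ ψ
  ∨I₁ : ∀ {φ ψ} → 𝒯 ⨾ Φ ⊢ φ → 𝒯 ⨾ Φ ⊢ φ ∨̇ ψ
  ∨I₂ : ∀ {φ ψ} → 𝒯 ⨾ Φ ⊢ ψ → 𝒯 ⨾ Φ ⊢ φ ∨̇ ψ
  ∨E  : ∀ {φ ψ χ} → 𝒯 ⨾ Φ ⊢ φ ∨̇ ψ → 𝒯 ⨾ φ ∷ Φ ⊢ χ → 𝒯 ⨾ ψ ∷ Φ ⊢ χ → 𝒯 ⨾ Φ ⊢ χ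
  ⊃I  : ∀ {φ ψ} → 𝒯 ⨾ φ ∷ Φ ⊢ ψ → 𝒯 ⨾ Φ ⊢ φ ⊃ ψ
  ⊃E  : ∀ {φ ψ} → 𝒯 ⨾ Φ ⊢ φ ⊃ ψ → 𝒯 ⨾ Φ ⊢ φ → 𝒯 ⨾ Φ ⊢ ψ
  ∀I  : ∀ {A φ} → 𝒯 ⨾ map (renF there) Φ ⊢ φ → 𝒯 ⨾ Φ ⊢ ∀̇[ A ] φ
  ∀E  : ∀ {A φ} → 𝒯 ⨾ Φ ⊢ ∀̇[ A ] φ → (t : Tm Γ A) → 𝒯 ⨾ Φ ⊢ φ [ t ]F
  ∃I  : ∀ {A φ} (t : Tm Γ A) → 𝒯 ⨾ Φ ⊢ φ [ t ]F → 𝒯 ⨾ Φ ⊢ ∃̇[ A ] φ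
  ∃E  : ∀ {A φ χ} → 𝒯 ⨾ Φ ⊢ ∃̇[ A ] φ →
        𝒯 ⨾ φ ∷ map (renF there) Φ ⊢ renF there χ → 𝒯 ⨾ Φ ⊢ χ

  ≐I  : ∀ {A} {t : Tm Γ A} → 𝒯 ⨾ Φ ⊢ t ≐ t
  ≐E  : ∀ {A} {t u : Tm Γ A} (φ : Formula (A ∷ Γ)) →
        𝒯 ⨾ Φ ⊢ t ≐ u → 𝒯 ⨾ Φ ⊢ φ [ t ]F → 𝒯 ⨾ Φ ⊢ φ [ u ]F

-- E-HA^ω: equality is primitive at every type, with the extensionality axiom.
data HAω (Γ : Ctx) : Formula Γ → Set where
  β   : ∀ {A B} (t : Tm (A ∷ Γ) B) (u : Tm Γ A) → HAω Γ (ƛ t · u ≐ t [ u ])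
  ext : ∀ {A B} (f g : Tm Γ (A ⇒ B)) →
        HAω Γ ((∀̇[ A ] ren there f · v0 ≐ ren there g · v0) ⊃ f ≐ g)

  cond-tt : ∀ {A} (t u : Tm Γ A) → HAω Γ (con cond · con tt · t · u ≐ t)
  cond-ff : ∀ {A} (t u : Tm Γ A) → HAω Γ (con cond · con ff · t · u ≐ u)
  𝔹-ind   : (φ : Formula (𝔹 ∷ Γ)) →
            HAω Γ (φ [ con tt ]F ⊃ φ [ con ff ]F ⊃ ∀̇[ 𝔹 ] φ)

  natrec-zero : ∀ {A} (a : Tm Γ A) f → HAω Γ (con natrec · a · f · con zero ≐ a)
  natrec-suc  : ∀ {A} (a : Tm Γ A) f n →
                HAω Γ (con natrec · a · f · (con suc · n) ≐
                       f · n · (con natrec · a · f · n))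
  suc≢zero    : (n : Tm Γ ℕ) → HAω Γ (con suc · n ≐ con zero ⊃ ⊥̇)
  suc-inj     : (m n : Tm Γ ℕ) → HAω Γ (con suc · m ≐ con suc · n ⊃ m ≐ n)
  ℕ-ind       : (φ : Formula (ℕ ∷ Γ)) →
                HAω Γ (φ [ con zero ]F ⊃
                       (∀̇[ ℕ ] φ ⊃ subF ((var ∘ there) ▹ (con suc · v0)) φ) ⊃
                       ∀̇[ ℕ ] φ)

  fst-pair : ∀ {A B} (a : Tm Γ A) (b : Tm Γ B) →
             HAω Γ (con fst · (con pair · a · b) ≐ a)
  snd-pair : ∀ {A B} (a : Tm Γ A) (b : Tm Γ B) →
             HAω Γ (con snd · (con pair · a · b) ≐ b)
  pair-η   : ∀ {A B} (p : Tm Γ (A ⊗ B)) →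
             HAω Γ (con pair · (con fst · p) · (con snd · p) ≐ p)

  listrec-nil  : ∀ {A B} (b : Tm Γ B) (f : Tm Γ (A ⇒ A ✶ ⇒ B ⇒ B)) →
                 HAω Γ (con listrec · b · f · con nil ≐ b)
  listrec-cons : ∀ {A B} (b : Tm Γ B) (f : Tm Γ (A ⇒ A ✶ ⇒ B ⇒ B)) x s →
                 HAω Γ (con listrec · b · f · (con cons · x · s) ≐
                        f · x · s · (con listrec · b · f · s))
  ✶-ind        : ∀ {A} (φ : Formula (A ✶ ∷ Γ)) →
                 HAω Γ (φ [ con nil ]F ⊃
                        (∀̇[ A ✶ ] φ ⊃
                          ∀̇[ A ] subF ((var ∘ there ∘ there) ▹ (con cons · v0 · v1)) φ) ⊃
                        ∀̇[ A ✶ ] φ)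

-- Relativised bar induction.
data BI (Γ : Ctx) : Formula Γ → Set where
  bar : ∀ {X} (S P : Formula (X ✶ ∷ Γ)) →
        let -- φ([α](n)) in the context n , α , Γ
            at-initial : Formula (X ✶ ∷ Γ) → Formula (ℕ ∷ X ^ℕ ∷ Γ)
            at-initial = subF ((var ∘ there ∘ there) ▹ (initial · v1 · v0))
            -- φ(s * x) in the context x , s , Γ
            at-snoc : Formula (X ✶ ∷ Γ) → Formula (X ∷ X ✶ ∷ Γ)
            at-snoc = subF ((var ∘ there ∘ there) ▹ (snoc · v1 · v0))
        in
        BI Γ (S [ con nil ]F ⊃
              (∀̇[ X ^ℕ ] (∀̇[ ℕ ] at-initial S) ⊃ (∃̇[ ℕ ] at-initial P)) ⊃
              (∀̇[ X ✶ ] S ⊃ (∀̇[ X ] at-snoc S ⊃ at-snoc P) ⊃ P) ⊃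
              P [ con nil ]F)

data CONT (Γ : Ctx) : Formula Γ → Set where
  cont : ∀ {X R} → Discrete R →
         CONT Γ (∀̇[ X ^ℕ ⇒ R ] ∀̇[ X ^ℕ ] ∃̇[ ℕ ] ∀̇[ X ^ℕ ]
                   (let q = v3; α = v2; n = v1; β = v0 in
                    initial · α · n ≐ initial · β · n ⊃ q · α ≐ q · β))

-- The defining equation has the specified functional as its only free variable.
record Functional : Set₁ where
  field
    Param    : Set
    type     : Param → Ty
    equation : (i : Param) → Formula (type i ∷ [])

-- The functional F is a parameter (free variable) of the derivation; since the
-- axioms of 𝒮 admit parameters, this is the same as adding a new constant.
_≥T[_]_ : Functional → Theory → Functional → Set
F ≥T[ 𝒮 ] G =
  (i : G.Param) → Σ[ j ∈ F.Param ] Σ[ s ∈ Tm [] (F.type j ⇒ G.type i) ]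
    𝒮 ⨾ F.equation j ∷ [] ⊢ subF ((λ ()) ▹ (ren there s · v0)) (G.equation i)
  where
  module F = Functional F
  module G = Functional G

record Types : Set where
  field
    X R        : Ty
    R-discrete : Discrete R

-- IPS_s(ε)(q) = c * IPS_{s*c}(ε)(q_c)  with  c = ε_s(λx. qₓ(IPS_{s*x}(ε)(qₓ)));
-- the functional takes its arguments in the order s, ε, q.
IPS : Functional
IPS = record
  { Param    = Types
  ; type     = λ i → let open Types i in
               X ✶ ⇒ (X ✶ ⇒ J R X) ⇒ (X ^ℕ ⇒ R) ⇒ X ^ℕ
  ; equation = λ i → let open Types i in
      ∀̇[ X ✶ ] ∀̇[ X ✶ ⇒ J R X ] ∀̇[ X ^ℕ ⇒ R ]
        (let ips = v3; s = v2; ε = v1; q = v0; c = control i in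
         ips · s · ε · q ≐
         prefix · c · (ips · (snoc · s · c) · ε · (shift · q · c)))
  }
  where
  -- c, in the context q , ε , s , IPS
  control : (i : Types) → let open Types i in
            Tm ((X ^ℕ ⇒ R) ∷ (X ✶ ⇒ J R X) ∷ X ✶ ∷
                (X ✶ ⇒ (X ✶ ⇒ J R X) ⇒ (X ^ℕ ⇒ R) ⇒ X ^ℕ) ∷ []) X
  control i =
    v1 · v2 · ƛ (let ips = v4; s = v3; ε = v2; q = v1; x = v0 in
                 shift · q · x · (ips · (snoc · s · x) · ε · (shift · q · x)))

-- MBR_s(ν)(q) = ν_s(λy. q_y(MBR_{s*y}(ν)(q_y))), with arguments in the order s, ν, q.
MBR : Functional
MBR = record
  { Param    = Types
  ; type     = λ i → let open Types i renaming (X to Y) in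
               Y ✶ ⇒ (Y ✶ ⇒ (Y ⇒ R) ⇒ Y ^ℕ) ⇒ (Y ^ℕ ⇒ R) ⇒ Y ^ℕ
  ; equation = λ i → let open Types i renaming (X to Y) in
      ∀̇[ Y ✶ ] ∀̇[ Y ✶ ⇒ (Y ⇒ R) ⇒ Y ^ℕ ] ∀̇[ Y ^ℕ ⇒ R ]
        (let mbr = v3; s = v2; ν = v1; q = v0 in mbr · s · ν · q) ≐
        v1 · v2 · ƛ (let mbr = v4; s = v3; ν = v2; q = v1; y = v0 in
                     shift · q · y · (mbr · (snoc · s · y) · ν · (shift · q · y)))
  }

{-# OPTIONS --safe #-}
module Submission where

-- Let MBR operate on blocks, i.e. finite nonempty sequences t * x, and let its outcome functional
-- be q ∘ flatten. At position s, its control function sees the value of every block y, and hence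
-- can compute a whole sequence α with α(n) = ε_{s*[α](n)}(λx. p([α](n) * x)). This is IPS, unfolded
-- to give each entry in terms of the initial segment before it, provided that MBR at the position
-- ⟨y⟩ relative to s agrees with MBR at the empty position relative to s * y. More generally, any two
-- positions that flatten to the same sequence have the same value q(MBR(q)): by continuity
-- q_{[α](n)} is constant for some n, and agreement is inherited from all one-block extensions by
-- the equation of MBR, so that bar induction applies.

open import Defs
open import Data.List.Base using (List; []; _∷_; map)
open import Data.List.Membership.Propositional using (_∈_)
open import Data.List.Relation.Unary.Any using (here; there)
import Data.Nat.Base as Nat
open import Data.Product.Base using (_,_)
open import Data.Sum.Base using (inj₁; inj₂)
open import Function.Base using (_∘_)
open import Relation.Binary.PropositionalEquality
  using (_≡_; refl; sym; trans; cong; cong₂; subst; subst₂)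

infix 4 _⊩_
infixr 2 _≐⟨_⟩_
infix 3 _∎

private variable
  Γ Δ Ξ : Ctx
  A B C D X R : Ty

_⊩_ : List (Formula Γ) → Formula Γ → Set
Φ ⊩ φ = HAω ⊕ BI ⊕ CONT ⨾ Φ ⊢ φ

private variable
  Φ : List (Formula Γ)
  φ : Formula Γ

-- Substitution in terms

sub-ext : {σ τ : Sub Γ Δ} → (∀ {A} (x : A ∈ Γ) → σ x ≡ τ x) →
          (t : Tm Γ A) → sub σ t ≡ sub τ t
sub-ext σ≗τ (var x) = σ≗τ x
sub-ext σ≗τ (con k) = refl
sub-ext σ≗τ (ƛ t)   = cong ƛ (sub-ext lifted t)
  where
  lifted : ∀ {A} (x : A ∈ _) → liftˢ _ x ≡ liftˢ _ x
  lifted (here refl) = refl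
  lifted (there x)   = cong (ren there) (σ≗τ x)
sub-ext σ≗τ (t · u) = cong₂ _·_ (sub-ext σ≗τ t) (sub-ext σ≗τ u)

sub-ren : (σ : Sub Δ Ξ) (ρ : Ren Γ Δ) (t : Tm Γ A) → sub σ (ren ρ t) ≡ sub (σ ∘ ρ) t
sub-ren σ ρ (var x) = refl
sub-ren σ ρ (con k) = refl
sub-ren σ ρ (ƛ t)   = cong ƛ (trans (sub-ren (liftˢ σ) (liftᴿ ρ) t) (sub-ext lifted t))
  where
  lifted : ∀ {A} (x : A ∈ _) → liftˢ σ (liftᴿ ρ x) ≡ liftˢ (σ ∘ ρ) x
  lifted (here refl) = refl
  lifted (there x)   = refl
sub-ren σ ρ (t · u) = cong₂ _·_ (sub-ren σ ρ t) (sub-ren σ ρ u)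

sub-id : {σ : Sub Γ Γ} → (∀ {A} (x : A ∈ Γ) → σ x ≡ var x) → (t : Tm Γ A) → sub σ t ≡ t
sub-id σ≗var (var x) = σ≗var x
sub-id σ≗var (con k) = refl
sub-id σ≗var (ƛ t)   = cong ƛ (sub-id lifted t)
  where
  lifted : ∀ {A} (x : A ∈ _) → liftˢ _ x ≡ var x
  lifted (here refl) = refl
  lifted (there x)   = cong (ren there) (σ≗var x)
sub-id σ≗var (t · u) = cong₂ _·_ (sub-id σ≗var t) (sub-id σ≗var u)

weaken-inst : (t : Tm Γ B) {u : Tm Γ A} → ren there t [ u ] ≡ t
weaken-inst t = trans (sub-ren _ there t) (sub-id (λ _ → refl) t)

lift-inst : (t : Tm (A ∷ Γ) B) → ren (liftᴿ there) t [ v0 ] ≡ t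
lift-inst t = trans (sub-ren _ (liftᴿ there) t)
                    (sub-id (λ { (here refl) → refl ; (there x) → refl }) t)

-- Equational reasoning inside the theory

ha : HAω Γ φ → Φ ⊩ φ
ha = axiom ∘ inj₁

≐-cong : (C : Tm (A ∷ Γ) B) {t u : Tm Γ A} → Φ ⊩ t ≐ u → Φ ⊩ C [ t ] ≐ C [ u ]
≐-cong {Φ = Φ} C {t} {u} t≐u =
  subst (λ z → Φ ⊩ z ≐ C [ u ]) (weaken-inst (C [ t ]))
    (≐E (ren there (C [ t ]) ≐ C) t≐u
      (subst (λ z → Φ ⊩ z ≐ C [ t ]) (sym (weaken-inst (C [ t ]))) ≐I))

≐-sym : {t u : Tm Γ A} → Φ ⊩ t ≐ u → Φ ⊩ u ≐ t
≐-sym {Φ = Φ} {t} {u} t≐u =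
  subst (λ z → Φ ⊩ u ≐ z) (weaken-inst t)
    (≐E (v0 ≐ ren there t) t≐u (subst (λ z → Φ ⊩ t ≐ z) (sym (weaken-inst t)) ≐I))

≐-trans : {t u v : Tm Γ A} → Φ ⊩ t ≐ u → Φ ⊩ u ≐ v → Φ ⊩ t ≐ v
≐-trans {Φ = Φ} {t} {u} {v} t≐u u≐v =
  subst (λ z → Φ ⊩ z ≐ v) (weaken-inst t)
    (≐E (ren there t ≐ v0) u≐v (subst (λ z → Φ ⊩ z ≐ u) (sym (weaken-inst t)) t≐u))

·-cong : {f g : Tm Γ (A ⇒ B)} {t u : Tm Γ A} → Φ ⊩ f ≐ g → Φ ⊩ t ≐ u → Φ ⊩ f · t ≐ g · u
·-cong {Φ = Φ} {f} {g} {t} {u} f≐g t≐u = ≐-trans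
  (subst₂ (λ y z → Φ ⊩ f · y ≐ g · z) (weaken-inst t) (weaken-inst t)
    (≐-cong (v0 · ren there t) f≐g))
  (subst₂ (λ y z → Φ ⊩ y · t ≐ z · u) (weaken-inst g) (weaken-inst g)
    (≐-cong (ren there g · v0) t≐u))

funext : {f g : Tm Γ (A ⇒ B)} →
         map (renF there) Φ ⊩ ren there f · v0 ≐ ren there g · v0 → Φ ⊩ f ≐ g
funext pointwise = ⊃E (ha (ext _ _)) (∀I pointwise)

ƛ-cong : {t u : Tm (A ∷ Γ) B} → map (renF there) Φ ⊩ t ≐ u → Φ ⊩ ƛ t ≐ ƛ u
ƛ-cong t≐u = funext (≐-trans (β-lift _) (≐-trans t≐u (≐-sym (β-lift _))))
  where
  β-lift : ∀ t → _ ⊩ ren there (ƛ t) · v0 ≐ t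
  β-lift t = subst (λ z → _ ⊩ ren there (ƛ t) · v0 ≐ z) (lift-inst t) (ha (β _ _))

_≐⟨_⟩_ : (t : Tm Γ A) {u v : Tm Γ A} → Φ ⊩ t ≐ u → Φ ⊩ u ≐ v → Φ ⊩ t ≐ v
t ≐⟨ t≐u ⟩ u≐v = ≐-trans t≐u u≐v

_∎ : (t : Tm Γ A) → Φ ⊩ t ≐ t
t ∎ = ≐I

-- The computational axioms are applied by reflection: terms with the same nf are provably equal.
data Redex {Γ B} (t : Tm Γ B) : Set where
  none : Redex t
  some : ∀ {u} → HAω Γ (t ≐ u) → Redex t

contract : (f : Tm Γ (A ⇒ B)) (u : Tm Γ A) → Redex (f · u)
contract (ƛ t)                 u                  = some (β t u)
contract (con fst)             (con pair · a · b) = some (fst-pair a b)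
contract (con snd)             (con pair · a · b) = some (snd-pair a b)
contract (con natrec · a · f)  (con zero)         = some (natrec-zero a f)
contract (con natrec · a · f)  (con suc · n)      = some (natrec-suc a f n)
contract (con listrec · b · f) (con nil)          = some (listrec-nil b f)
contract (con listrec · b · f) (con cons · x · s) = some (listrec-cons b f x s)
contract _                     _                  = none

-- The number bounds the depth of nested contractions.
nf       : Nat.ℕ → Tm Γ A → Tm Γ A
nf-app   : Nat.ℕ → Tm Γ (A ⇒ B) → Tm Γ A → Tm Γ B
nf-redex : Nat.ℕ → {t : Tm Γ A} → Redex t → Tm Γ A

nf n (var x) = var x
nf n (con k) = con k
nf n (ƛ t)   = ƛ (nf n t)
nf n (t · u) = nf-app n (nf n t) (nf n u)

nf-app Nat.zero    f u = f · u
nf-app (Nat.suc n) f u = nf-redex n (contract f u)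

nf-redex n {t} none         = t
nf-redex n     (some {u} _) = nf n u

nf-sound       : ∀ n (t : Tm Γ A) → Φ ⊩ t ≐ nf n t
nf-app-sound   : ∀ n (f : Tm Γ (A ⇒ B)) u → Φ ⊩ f · u ≐ nf-app n f u
nf-redex-sound : ∀ n {t : Tm Γ A} (r : Redex t) → Φ ⊩ t ≐ nf-redex n r

nf-sound n (var x) = ≐I
nf-sound n (con k) = ≐I
nf-sound n (ƛ t)   = ƛ-cong (nf-sound n t)
nf-sound n (t · u) = ≐-trans (·-cong (nf-sound n t) (nf-sound n u)) (nf-app-sound n _ _)

nf-app-sound Nat.zero    f u = ≐I
nf-app-sound (Nat.suc n) f u = nf-redex-sound n (contract f u)

nf-redex-sound n none         = ≐I
nf-redex-sound n (some {u} h) = ≐-trans (ha h) (nf-sound n u)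

-- `nf-sound` holds for every bound; 100 is merely a generous depth.
by-nf : {t u : Tm Γ A} → nf 100 t ≡ nf 100 u → Φ ⊩ t ≐ u
by-nf {t = t} {u} eq =
  ≐-trans (nf-sound 100 t) (subst (λ z → _ ⊩ z ≐ u) (sym eq) (≐-sym (nf-sound 100 u)))

-- Derived rules of induction and instantiation

ℕ-induction : (φ : Formula (ℕ ∷ Γ)) → Φ ⊩ φ [ con zero ]F →
              φ ∷ map (renF there) Φ ⊩ subF ((var ∘ there) ▹ (con suc · v0)) φ →
              Φ ⊩ ∀̇[ ℕ ] φ
ℕ-induction φ base step = ⊃E (⊃E (ha (ℕ-ind φ)) base) (∀I (⊃I step))

✶-induction : (φ : Formula (A ✶ ∷ Γ)) → Φ ⊩ φ [ con nil ]F →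
              map (renF there) (φ ∷ map (renF there) Φ) ⊩
                subF ((var ∘ there ∘ there) ▹ (con cons · v0 · v1)) φ →
              Φ ⊩ ∀̇[ A ✶ ] φ
✶-induction φ base step = ⊃E (⊃E (ha (✶-ind φ)) base) (∀I (⊃I (∀I step)))

∀E₂ : {φ : Formula (B ∷ A ∷ Γ)} → Φ ⊩ ∀̇[ A ] ∀̇[ B ] φ → (t : Tm Γ A) (u : Tm Γ B) →
      Φ ⊩ subF (liftˢ (var ▹ t)) φ [ u ]F
∀E₂ p t u = ∀E (∀E p t) u

∀E₃ : {φ : Formula (C ∷ B ∷ A ∷ Γ)} → Φ ⊩ ∀̇[ A ] ∀̇[ B ] ∀̇[ C ] φ →
      (t : Tm Γ A) (u : Tm Γ B) (v : Tm Γ C) →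
      Φ ⊩ subF (liftˢ (var ▹ u)) (subF (liftˢ (liftˢ (var ▹ t))) φ) [ v ]F
∀E₃ p t u v = ∀E (∀E₂ p t u) v

∀E₄ : {φ : Formula (D ∷ C ∷ B ∷ A ∷ Γ)} → Φ ⊩ ∀̇[ A ] ∀̇[ B ] ∀̇[ C ] ∀̇[ D ] φ →
      (t : Tm Γ A) (u : Tm Γ B) (v : Tm Γ C) (w : Tm Γ D) →
      Φ ⊩ subF (liftˢ (var ▹ v)) (subF (liftˢ (liftˢ (var ▹ u)))
            (subF (liftˢ (liftˢ (liftˢ (var ▹ t)))) φ)) [ w ]F
∀E₄ p t u v w = ∀E (∀E₃ p t u v) w

h0 : ∀ {φ} → φ ∷ Φ ⊩ φ
h0 = hyp (here refl)

h1 : ∀ {φ ψ} → ψ ∷ φ ∷ Φ ⊩ φ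
h1 = hyp (there (here refl))

h3 : ∀ {φ ψ χ ξ} → ξ ∷ χ ∷ ψ ∷ φ ∷ Φ ⊩ φ
h3 = hyp (there (there (there (here refl))))

v5 : ∀ {A B C D E F} → Tm (F ∷ E ∷ D ∷ C ∷ B ∷ A ∷ Γ) A
v5 = var (there (there (there (there (there (here refl))))))

v6 : ∀ {A B C D E F G} → Tm (G ∷ F ∷ E ∷ D ∷ C ∷ B ∷ A ∷ Γ) A
v6 = var (there (there (there (there (there (there (here refl)))))))

v7 : ∀ {A B C D E F G H} → Tm (H ∷ G ∷ F ∷ E ∷ D ∷ C ∷ B ∷ A ∷ Γ) A
v7 = var (there (there (there (there (there (there (there (here refl))))))))

v8 : ∀ {A B C D E F G H I} → Tm (I ∷ H ∷ G ∷ F ∷ E ∷ D ∷ C ∷ B ∷ A ∷ Γ) A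
v8 = var (there (there (there (there (there (there (there (there (here refl)))))))))

v9 : ∀ {A B C D E F G H I J} → Tm (J ∷ I ∷ H ∷ G ∷ F ∷ E ∷ D ∷ C ∷ B ∷ A ∷ Γ) A
v9 = var (there (there (there (there (there (there (there (there (there (here refl))))))))))

-- Sequences and folds

-- At a variable index `prefix` does not compute. Induction serves as the case distinction between
-- the first entry and the later ones.
prefix-ext : Φ ⊩ ∀̇[ X ^ℕ ] ∀̇[ X ] ∀̇[ X ^ℕ ]
  (let f = v2; x = v1; γ = v0 in
   f · con zero ≐ x ⊃ (∀̇[ ℕ ] v3 · (con suc · v0) ≐ v1 · v0) ⊃ f ≐ prefix · x · γ)
prefix-ext = ∀I (∀I (∀I (⊃I (⊃I (funext
  (∀E (ℕ-induction (v4 · v0 ≐ prefix · v3 · v2 · v0)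
    (≐-trans h1 (by-nf refl))
    (≐-trans (∀E h1 v0) (by-nf refl))) v0))))))

-- Concatenation is written foldl · snoc, since then s * ⟨⟩ = s and (s * ⟨c⟩) * t = s * (⟨c⟩ * t)
-- hold by computation.
foldl : Tm Γ ((B ⇒ A ⇒ B) ⇒ B ⇒ A ✶ ⇒ B)
foldl = ƛ (ƛ (ƛ (con listrec · ƛ v0 · ƛ (ƛ (ƛ (ƛ (v1 · (v6 · v0 · v3))))) · v0 · v1)))

-- The start value `b` is quantified inside the induction formula, since each `cons` changes it.
foldl-snoc : Φ ⊩ ∀̇[ B ⇒ A ⇒ B ] ∀̇[ A ] ∀̇[ A ✶ ] ∀̇[ B ]
  (let f = v3; x = v2; s = v1; b = v0 in
   foldl · f · b · (snoc · s · x) ≐ f · (foldl · f · b · s) · x)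
foldl-snoc = ∀I (∀I (✶-induction
  (∀̇[ _ ] foldl · v3 · v0 · (snoc · v1 · v2) ≐ v3 · (foldl · v3 · v0 · v1) · v2)
  (∀I (by-nf refl))
  (∀I (
    foldl · v4 · v0 · (snoc · (con cons · v1 · v2) · v3)   ≐⟨ by-nf refl ⟩
    foldl · v4 · (v4 · v0 · v1) · (snoc · v2 · v3)         ≐⟨ ∀E h0 (v4 · v0 · v1) ⟩
    v4 · (foldl · v4 · (v4 · v0 · v1) · v2) · v3           ≐⟨ by-nf refl ⟩
    v4 · (foldl · v4 · v0 · (con cons · v1 · v2)) · v3     ∎))))

⟪_,_⟫ : Tm Γ A → Tm Γ B → Tm Γ (A ⊗ B)
⟪ a , b ⟫ = con pair · a · b

-- `contract` has no η-rule, so η comes from extensionality.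
eta : Φ ⊩ ∀̇[ A ⇒ B ] ƛ (v1 · v0) ≐ v0
eta = ∀I (funext (by-nf refl))

-- Blocks and flattening

tail : Tm Γ (X ^ℕ ⇒ X ^ℕ)
tail = ƛ (ƛ (v1 · (con suc · v0)))

-- ⟪ t , x ⟫ stands for the nonempty sequence t * x.
Block : Ty → Ty
Block X = X ✶ ⊗ X

join : Tm Γ (X ✶ ⇒ Block X ⇒ X ✶)
join = ƛ (ƛ (snoc · (foldl · snoc · v1 · (con fst · v0)) · (con snd · v0)))

blockPrefix : Tm Γ (Block X ⇒ X ^ℕ ⇒ X ^ℕ)
blockPrefix = ƛ (ƛ (con listrec · (prefix · (con snd · v1) · v0) ·
                    ƛ (ƛ (ƛ (prefix · v2 · v0))) · (con fst · v1)))

-- flattened, this drops the first entry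
dropFirst : Tm Γ (Block X ^ℕ ⇒ Block X ^ℕ)
dropFirst = ƛ (con listrec · (tail · v0) ·
               ƛ (ƛ (ƛ (prefix · ⟪ v1 , con snd · (v3 · con zero) ⟫ · (tail · v3)))) ·
               (con fst · (v0 · con zero)))

-- Entry n is the first entry left after n uses of `dropFirst`. The recursion yields functions of
-- the sequence, so that the successor case computes.
flatten : Tm Γ (Block X ^ℕ ⇒ X ^ℕ)
flatten = ƛ (ƛ (con natrec ·
  ƛ (con listrec · (con snd · (v0 · con zero)) · ƛ (ƛ (ƛ v2)) · (con fst · (v0 · con zero))) ·
  ƛ (ƛ (ƛ (v1 · (dropFirst · v0)))) · v0 · v1))

-- Induction on t: `dropFirst` removes one entry of the first block, which leaves the instance for
-- the shorter t.
flatten-prefix : Φ ⊩ ∀̇[ Block X ^ℕ ] ∀̇[ X ] ∀̇[ X ✶ ]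
  (let α = v2; x = v1; t = v0 in
   flatten · (prefix · ⟪ t , x ⟫ · α) ≐ blockPrefix · ⟪ t , x ⟫ · (flatten · α))
flatten-prefix = ∀I (∀I (✶-induction
  (flatten · (prefix · ⟪ v0 , v1 ⟫ · v2) ≐ blockPrefix · ⟪ v0 , v1 ⟫ · (flatten · v2))
  (≐-trans
    (⊃E (⊃E (∀E₃ prefix-ext (flatten · (prefix · ⟪ con nil , v0 ⟫ · v1)) v0 (flatten · v1))
      (by-nf refl))
      (∀I (
        flatten · (prefix · ⟪ con nil , v1 ⟫ · v2) · (con suc · v0) ≐⟨ by-nf refl ⟩
        -- Dropping a one-entry block leaves α only up to η.
        flatten · ƛ (v3 · v0) · v0 ≐⟨ ≐-cong (flatten · v0 · v1) (∀E eta v2) ⟩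
        flatten · v2 · v0 ∎)))
    (by-nf refl))
  (≐-trans
    (⊃E (⊃E (∀E₃ prefix-ext (flatten · (prefix · ⟪ con cons · v0 · v1 , v2 ⟫ · v3)) v0
                            (flatten · (prefix · ⟪ v1 , v2 ⟫ · v3)))
      (by-nf refl))
      (∀I (by-nf refl)))
    (≐-trans (≐-cong (prefix · v1 · v0) h0) (by-nf refl)))))

singletons : Tm Γ (X ^ℕ ⇒ Block X ^ℕ)
singletons = ƛ (ƛ ⟪ con nil , v1 · v0 ⟫)

-- On one-entry blocks `dropFirst` acts as `tail`, so the sequence varies in the induction.
flatten-singletons : Φ ⊩ ∀̇[ X ^ℕ ] flatten · (singletons · v0) ≐ v0
flatten-singletons = ∀I (funext (∀E₂ (ℕ-induction
  (∀̇[ _ ] flatten · (singletons · v0) · v1 ≐ v0 · v1)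
  (∀I (by-nf refl))
  (∀I (
    flatten · (singletons · v0) · (con suc · v1)    ≐⟨ by-nf refl ⟩
    flatten · (singletons · (tail · v0)) · v1       ≐⟨ ∀E h0 (tail · v0) ⟩
    tail · v0 · v1                                  ≐⟨ by-nf refl ⟩
    v0 · (con suc · v1)                             ∎))) v0 v1))

-- Sequences generated from their initial segments

-- This is [α](n) for α = `unfold · f`, built without reference to α.
iterates : Tm Γ ((X ✶ ⇒ X) ⇒ ℕ ⇒ X ✶)
iterates = ƛ (ƛ (con natrec · con nil · ƛ (ƛ (snoc · v0 · (v3 · v0))) · v0))

-- f ↦ the sequence α with α(n) = f([α](n))
unfold : Tm Γ ((X ✶ ⇒ X) ⇒ X ^ℕ)
unfold = ƛ (ƛ (v1 · (iterates · v1 · v0)))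

-- The rule that generates the tail of `unfold · f`.
advance : Tm Γ ((X ✶ ⇒ X) ⇒ X ✶ ⇒ X)
advance = ƛ (ƛ (v1 · (con cons · (v1 · con nil) · v0)))

-- `iterates` grows at its end, whereas the equation of `IPS` splits off the first entry.
iterates-suc : Φ ⊩ ∀̇[ X ✶ ⇒ X ] ∀̇[ ℕ ]
  iterates · v1 · (con suc · v0) ≐ con cons · (v1 · con nil) · (iterates · (advance · v1) · v0)
iterates-suc = ∀I (ℕ-induction
  (iterates · v1 · (con suc · v0) ≐ con cons · (v1 · con nil) · (iterates · (advance · v1) · v0))
  (by-nf refl)
  (≐-trans (by-nf refl) (≐-trans (≐-cong (snoc · v0 · (v2 · v0)) h0) (by-nf refl))))

unfold-prefix : Φ ⊩ ∀̇[ X ✶ ⇒ X ]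
  unfold · v0 ≐ prefix · (v0 · con nil) · (unfold · (advance · v0))
unfold-prefix = ∀I (⊃E (⊃E
  (∀E₃ prefix-ext (unfold · v0) (v0 · con nil) (unfold · (advance · v0)))
  (by-nf refl))
  (∀I (
    unfold · v1 · (con suc · v0)             ≐⟨ by-nf refl ⟩
    v1 · (iterates · v1 · (con suc · v0))    ≐⟨ ≐-cong (v2 · v0) (∀E₂ iterates-suc v1 v0) ⟩
    v1 · (con cons · (v1 · con nil) · (iterates · (advance · v1) · v0)) ≐⟨ by-nf refl ⟩
    unfold · (advance · v1) · v0             ∎)))

-- Overwriting and continuity

plus : Tm Γ (ℕ ⇒ ℕ ⇒ ℕ)
plus = ƛ (ƛ (con natrec · v1 · ƛ (ƛ (con suc · v0)) · v0))

plus-zero : Φ ⊩ ∀̇[ ℕ ] plus · con zero · v0 ≐ v0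
plus-zero = ℕ-induction (plus · con zero · v0 ≐ v0)
  (by-nf refl)
  (≐-trans (by-nf refl) (≐-cong (con suc · v0) h0))

plus-suc : Φ ⊩ ∀̇[ ℕ ] ∀̇[ ℕ ] plus · (con suc · v1) · v0 ≐ plus · v1 · (con suc · v0)
plus-suc = ∀I (ℕ-induction (plus · (con suc · v1) · v0 ≐ plus · v1 · (con suc · v0))
  (by-nf refl)
  (≐-trans (by-nf refl) (≐-trans (≐-cong (con suc · v0) h0) (by-nf refl))))

-- α , n , γ ↦ [α](n) * γ
overwrite : Tm Γ (X ^ℕ ⇒ ℕ ⇒ X ^ℕ ⇒ X ^ℕ)
overwrite = ƛ (ƛ (ƛ (con natrec · ƛ v0 · ƛ (ƛ (ƛ (v1 · (prefix · (v5 · v2) · v0)))) · v1 · v0)))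

-- Going from n to n + 1 replaces γ by α(n) * γ, so γ varies in the induction.
overwrite-beyond : Φ ⊩ ∀̇[ X ^ℕ ] ∀̇[ ℕ ] ∀̇[ X ^ℕ ] ∀̇[ ℕ ]
  (let α = v3; n = v2; γ = v1; k = v0 in
   overwrite · α · n · γ · (plus · n · k) ≐ γ · k)
overwrite-beyond = ∀I (ℕ-induction
  (∀̇[ _ ] ∀̇[ ℕ ] overwrite · v3 · v2 · v1 · (plus · v2 · v0) ≐ v1 · v0)
  (∀I (∀I (
    overwrite · v2 · con zero · v1 · (plus · con zero · v0) ≐⟨ by-nf refl ⟩
    v1 · (plus · con zero · v0)                             ≐⟨ ≐-cong (v2 · v0) (∀E plus-zero v0) ⟩
    v1 · v0                                                 ∎)))
  (∀I (∀I (
    let δ = prefix · (v3 · v2) · v1 in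
    overwrite · v3 · (con suc · v2) · v1 · (plus · (con suc · v2) · v0)
      ≐⟨ ≐-cong (overwrite · v4 · (con suc · v3) · v2 · v0) (∀E₂ plus-suc v2 v0) ⟩
    overwrite · v3 · (con suc · v2) · v1 · (plus · v2 · (con suc · v0)) ≐⟨ by-nf refl ⟩
    overwrite · v3 · v2 · δ · (plus · v2 · (con suc · v0)) ≐⟨ ∀E₂ h0 δ (con suc · v0) ⟩
    δ · (con suc · v0) ≐⟨ by-nf refl ⟩
    v1 · v0 ∎))))

initial-overwrite : Φ ⊩ ∀̇[ X ^ℕ ] ∀̇[ ℕ ] ∀̇[ X ^ℕ ]
  (let α = v2; n = v1; γ = v0 in initial · (overwrite · α · n · γ) · n ≐ initial · α · n)
initial-overwrite = ∀I (ℕ-induction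
  (∀̇[ _ ] initial · (overwrite · v2 · v1 · v0) · v1 ≐ initial · v2 · v1)
  (∀I (by-nf refl))
  (∀I (
    let δ = overwrite · v2 · v1 · (prefix · (v2 · v1) · v0) in
    initial · (overwrite · v2 · (con suc · v1) · v0) · (con suc · v1) ≐⟨ by-nf refl ⟩
    -- Index n is written n + 0, so that `overwrite-beyond` finds α(n) there.
    snoc · (initial · δ · v1) · (δ · (plus · v1 · con zero))
      ≐⟨ ·-cong (·-cong ≐I (∀E h0 (prefix · (v2 · v1) · v0)))
                (∀E (∀E₃ overwrite-beyond v2 v1 (prefix · (v2 · v1) · v0)) (con zero)) ⟩
    snoc · (initial · v2 · v1) · (prefix · (v2 · v1) · v0 · con zero) ≐⟨ by-nf refl ⟩
    initial · v2 · (con suc · v1) ∎)))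

-- `foldl · shift · q · t` is q_t, built one entry at a time.
shift-overwrite : Φ ⊩ ∀̇[ X ^ℕ ⇒ R ] ∀̇[ X ^ℕ ] ∀̇[ ℕ ] ∀̇[ X ^ℕ ]
  (let q = v3; α = v2; n = v1; γ = v0 in
   foldl · shift · q · (initial · α · n) · γ ≐ q · (overwrite · α · n · γ))
shift-overwrite = ∀I (∀I (ℕ-induction
  (∀̇[ _ ] foldl · shift · v3 · (initial · v2 · v1) · v0 ≐ v3 · (overwrite · v2 · v1 · v0))
  (∀I (by-nf refl))
  (∀I (
    foldl · shift · v3 · (initial · v2 · (con suc · v1)) · v0 ≐⟨ by-nf refl ⟩
    foldl · shift · v3 · (snoc · (initial · v2 · v1) · (v2 · v1)) · v0
      ≐⟨ ≐-cong (v0 · v1) (∀E (∀E₃ foldl-snoc shift (v2 · v1) (initial · v2 · v1)) v3) ⟩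
    shift · (foldl · shift · v3 · (initial · v2 · v1)) · (v2 · v1) · v0 ≐⟨ by-nf refl ⟩
    foldl · shift · v3 · (initial · v2 · v1) · (prefix · (v2 · v1) · v0)
      ≐⟨ ∀E h0 (prefix · (v2 · v1) · v0) ⟩
    v3 · (overwrite · v2 · v1 · (prefix · (v2 · v1) · v0)) ≐⟨ by-nf refl ⟩
    v3 · (overwrite · v2 · (con suc · v1) · v0) ∎))))

-- Take n from continuity of q at α: every [α](n) * γ agrees with α up to n.
eventually-constant : Discrete R → Φ ⊩ ∀̇[ X ^ℕ ⇒ R ] ∀̇[ X ^ℕ ] ∃̇[ ℕ ] ∀̇[ X ^ℕ ]
  (let q = v3; α = v2; n = v1; γ = v0 in foldl · shift · q · (initial · α · n) · γ ≐ q · α)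
eventually-constant R-discrete = ∀I (∀I (∃E
  (∀E₂ (axiom (inj₂ (inj₂ (cont R-discrete)))) v1 v0)
  (∃I v0 (∀I (≐-trans
    (∀E₄ shift-overwrite v3 v2 v1 v0)
    (≐-sym (⊃E (∀E h0 (overwrite · v2 · v1 · v0)) (≐-sym (∀E₃ initial-overwrite v2 v1 v0)))))))))

-- The control function given to MBR

-- The generated sequence over X is returned in one-entry blocks, the form that MBR expects.
respond : Tm Γ ((X ✶ ⇒ J R X) ⇒ X ✶ ⇒ (Block X ⇒ R) ⇒ Block X ^ℕ)
respond = ƛ (ƛ (ƛ (let ε = v3; s = v2; p = v1; t = v0 in
  singletons · (unfold · ƛ (ε · (foldl · snoc · s · t) · ƛ (v2 · ⟪ v1 , v0 ⟫))))))

-- Only the flattened position foldl · join · s · u matters, on which the uniqueness of MBR rests.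
ν : Tm Γ ((X ✶ ⇒ J R X) ⇒ X ✶ ⇒ Block X ✶ ⇒ (Block X ⇒ R) ⇒ Block X ^ℕ)
ν = ƛ (ƛ (ƛ (respond · v2 · (foldl · join · v1 · v0))))

cut : ∀ {ψ} → Φ ⊩ φ → φ ∷ Φ ⊩ ψ → Φ ⊩ ψ
cut p d = ⊃E (⊃I d) p

-- Uniqueness of values by bar induction

module _ {X R : Ty} where

  MBRType : Ty
  MBRType = Block X ✶ ⇒ (Block X ✶ ⇒ (Block X ⇒ R) ⇒ Block X ^ℕ) ⇒
            (Block X ^ℕ ⇒ R) ⇒ Block X ^ℕ

  -- All that is used of the MBR equation from here on. With `ν` evaluated, the position enters the
  -- arguments of `respond` before the continuation only in flattened form.
  Respond : Formula (MBRType ∷ [])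
  Respond = ∀̇[ X ✶ ⇒ J R X ] ∀̇[ Block X ^ℕ ⇒ R ] ∀̇[ X ✶ ] ∀̇[ Block X ✶ ]
    (v4 · v0 · (ν · v3 · v1) · v2 ≐
     respond · v3 · (foldl · join · v1 · v0) ·
       ƛ (let m = v5; ε = v4; q = v3; s = v2; u = v1; y = v0 in
          shift · q · y · (m · (snoc · u · y) · (ν · ε · s) · (shift · q · y))))

  mbr-respond : (R-discrete : Discrete R) →
    Functional.equation MBR (record { X = Block X ; R = R ; R-discrete = R-discrete }) ∷ Φ ⊩ Respond
  mbr-respond _ = ∀I (∀I (∀I (∀I (≐-trans (∀E₃ h0 v0 (ν · v3 · v1) v2) (·-cong (by-nf refl) ≐I)))))

  Unique : Formula (MBRType ∷ [])
  Unique = ∀̇[ X ✶ ⇒ J R X ] ∀̇[ Block X ^ℕ ⇒ R ] ∀̇[ X ✶ ] ∀̇[ Block X ✶ ] ∀̇[ X ✶ ] ∀̇[ Block X ✶ ]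
    (let m = v6; ε = v5; q = v4; s = v3; u = v2; s′ = v1; u′ = v0 in
     foldl · join · s · u ≐ foldl · join · s′ · u′ ⊃
     q · (m · u · (ν · ε · s) · q) ≐ q · (m · u′ · (ν · ε · s′) · q))

  unique : Discrete R → Respond ∷ Φ ⊩ Unique
  unique R-discrete = ∀I (∀I (≐E
    (∀̇[ X ✶ ] ∀̇[ Block X ✶ ] ∀̇[ X ✶ ] ∀̇[ Block X ✶ ]
      (foldl · join · v3 · v2 ≐ foldl · join · v1 · v0 ⊃
       v4 · (v7 · v2 · (ν · v6 · v3) · v4) ≐ v4 · (v7 · v0 · (ν · v6 · v1) · v4)))
    -- Bar induction ends at q_⟨⟩, which computes to q.
    (by-nf {t = foldl · shift · v0 · con nil} refl)
    (⊃E (⊃E (⊃E (axiom (inj₂ (inj₁ (bar S P)))) ≐I) at-bar) step)))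
    where
    S P : Formula (Block X ✶ ∷ (Block X ^ℕ ⇒ R) ∷ (X ✶ ⇒ J R X) ∷ MBRType ∷ [])
    S = v0 ≐ v0
    P = ∀̇[ X ✶ ] ∀̇[ Block X ✶ ] ∀̇[ X ✶ ] ∀̇[ Block X ✶ ]
      (foldl · join · v3 · v2 ≐ foldl · join · v1 · v0 ⊃
       let q = foldl · shift · v5 · v4 in
       q · (v7 · v2 · (ν · v6 · v3) · q) ≐ q · (v7 · v0 · (ν · v6 · v1) · q))

    -- Where q_w is constant, both sides equal q(α).
    at-bar = ∀I (⊃I (∃E (∀E₂ (eventually-constant R-discrete) v1 v0)
      (∃I v0 (∀I (∀I (∀I (∀I (⊃I (≐-trans (∀E h1 _) (≐-sym (∀E h1 _)))))))))))

    step = ∀I (⊃I (⊃I (∀I (∀I (∀I (∀I (⊃I (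
      let m = v7; ε = v6; s = v3; u = v2; s′ = v1; u′ = v0; q = foldl · shift · v5 · v4 in
      ·-cong {f = q} ≐I (
      m · u · (ν · ε · s) · q
        ≐⟨ ∀E₄ h3 ε q s u ⟩
      respond · ε · (foldl · join · s · u) ·
        ƛ (let q = shift · (foldl · shift · v6 · v5) · v0 in
           q · (v8 · (snoc · v3 · v0) · (ν · v7 · v4) · q))
        -- The flattened positions agree by hypothesis. For each y, (q_w)_y is q_{w*y}, so the
        -- continuations agree by `P` at w * y, used for the two positions extended by y.
        ≐⟨ ·-cong (·-cong ≐I h0) (ƛ-cong (≐E
             (v0 · (v9 · (snoc · v4 · v1) · (ν · v8 · v5) · v0) ≐
              v0 · (v9 · (snoc · v2 · v1) · (ν · v8 · v3) · v0))
             (∀E₄ foldl-snoc shift v0 v5 v6)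
             (⊃E (∀E₄ (⊃E (∀E h1 v0) ≐I) v4 (snoc · v3 · v0) v2 (snoc · v1 · v0)) (
               foldl · join · v4 · (snoc · v3 · v0)  ≐⟨ ∀E₄ foldl-snoc join v0 v3 v4 ⟩
               join · (foldl · join · v4 · v3) · v0  ≐⟨ ≐-cong (join · v0 · v1) h0 ⟩
               join · (foldl · join · v2 · v1) · v0  ≐⟨ ≐-sym (∀E₄ foldl-snoc join v0 v1 v2) ⟩
               foldl · join · v2 · (snoc · v1 · v0)  ∎)))) ⟩
      respond · ε · (foldl · join · s′ · u′) ·
        ƛ (let q = shift · (foldl · shift · v6 · v5) · v0 in
           q · (v8 · (snoc · v1 · v0) · (ν · v7 · v2) · q))
        ≐⟨ ≐-sym (∀E₄ h3 ε q s′ u′) ⟩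
      m · u′ · (ν · ε · s′) · q ∎)))))))))

  -- IPS from MBR

  blockShift : Tm Γ ((X ^ℕ ⇒ R) ⇒ Block X ⇒ X ^ℕ ⇒ R)
  blockShift = ƛ (ƛ (ƛ (v2 · (blockPrefix · v1 · v0))))

  -- The position s is handed to `ν` as an offset, while MBR itself starts from the empty position.
  ips : Tm Γ (MBRType ⇒ X ✶ ⇒ (X ✶ ⇒ J R X) ⇒ (X ^ℕ ⇒ R) ⇒ X ^ℕ)
  ips = ƛ (ƛ (ƛ (ƛ (let m = v3; s = v2; ε = v1; q = v0 in
    flatten · (m · con nil · (ν · ε · s) · ƛ (v1 · (flatten · v0)))))))

  -- m , ε , q , s , t ↦ the entry of IPS_s(ε)(q) that follows its initial segment t
  choice : Tm Γ (MBRType ⇒ (X ✶ ⇒ J R X) ⇒ (X ^ℕ ⇒ R) ⇒ X ✶ ⇒ X ✶ ⇒ X)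
  choice = ƛ (ƛ (ƛ (ƛ (ƛ (v3 · (foldl · snoc · v1 · v0) ·
    ƛ (let m = v5; ε = v4; q = v3; s = v2; t = v1; x = v0 in
       blockShift · q · ⟪ t , x ⟫ ·
         (ips · m · (join · s · ⟪ t , x ⟫) · ε · (blockShift · q · ⟪ t , x ⟫))))))))

  Unfolds : Formula (MBRType ∷ [])
  Unfolds = ∀̇[ X ✶ ⇒ J R X ] ∀̇[ X ^ℕ ⇒ R ] ∀̇[ X ✶ ]
    ips · v3 · v0 · v2 · v1 ≐ unfold · (choice · v3 · v2 · v1 · v0)

  ips-unfolds : Unique ∷ Respond ∷ Φ ⊩ Unfolds
  ips-unfolds = ∀I (∀I (∀I (
    let m = v3; ε = v2; q = v1; s = v0; q° = ƛ (v2 · (flatten · v0)) in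
    ips · m · s · ε · q
      ≐⟨ by-nf refl ⟩
    flatten · (m · con nil · (ν · ε · s) · q°)
      ≐⟨ ≐-cong (flatten · v0) (∀E₄ h1 ε q° s (con nil)) ⟩
    flatten · (respond · ε · (foldl · join · s · con nil) ·
      ƛ (let q° = ƛ (v3 · (flatten · v0)) in
         shift · q° · v0 · (v4 · (snoc · con nil · v0) · (ν · v3 · v1) · (shift · q° · v0))))
      ≐⟨ ·-cong ≐I (by-nf refl) ⟩
    flatten · (singletons · (unfold · ƛ (v3 · (foldl · snoc · v1 · v0) · ƛ (
      let y = ⟪ v1 , v0 ⟫; q = shift · ƛ (v4 · (flatten · v0)) · y in
      q · (v5 · (snoc · con nil · y) · (ν · v4 · v2) · q)))))
      ≐⟨ ∀E flatten-singletons _ ⟩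
    unfold · ƛ (v3 · (foldl · snoc · v1 · v0) · ƛ (
      let y = ⟪ v1 , v0 ⟫; q = shift · ƛ (v4 · (flatten · v0)) · y in
      q · (v5 · (snoc · con nil · y) · (ν · v4 · v2) · q)))
      ≐⟨ ·-cong ≐I (ƛ-cong (·-cong ≐I (ƛ-cong (
           let m = v5; ε = v4; s = v2; y = ⟪ v1 , v0 ⟫; q = shift · ƛ (v4 · (flatten · v0)) · y in
           ≐-trans
             -- `Unique` trades position ⟨y⟩ with offset s for the empty position with offset s * y;
             -- both flatten alike by computation.
             (⊃E (∀E (∀E (∀E₄ h0 ε q s (snoc · con nil · y)) (join · s · y)) (con nil)) (by-nf refl))
             (≐-trans
               -- (q ∘ flatten)_y is q_y ∘ flatten, the outcome functional inside `ips`.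
               (≐-cong (v0 · (v6 · con nil · (ν · v5 · (join · v3 · ⟪ v2 , v1 ⟫)) · v0))
                 {u = ƛ (v4 · (blockPrefix · ⟪ v2 , v1 ⟫ · (flatten · v0)))}
                 (≐-trans (by-nf {u = ƛ (v4 · (flatten · (prefix · ⟪ v2 , v1 ⟫ · v0)))} refl)
                          (ƛ-cong (≐-cong (v5 · v0) (∀E₃ flatten-prefix v0 v1 v2)))))
               (by-nf refl)))))) ⟩
    unfold · ƛ (v3 · (foldl · snoc · v1 · v0) · ƛ (
      let q = blockShift · v3 · ⟪ v1 , v0 ⟫ in
      q · (ips · v5 · (join · v2 · ⟪ v1 , v0 ⟫) · v4 · q)))
      ≐⟨ ·-cong ≐I (by-nf refl) ⟩
    unfold · (choice · m · ε · q · s) ∎)))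

  ips-equation : Unfolds ∷ Φ ⊩ ∀̇[ X ✶ ] ∀̇[ X ✶ ⇒ J R X ] ∀̇[ X ^ℕ ⇒ R ]
    (let c = v1 · v2 · ƛ (let m = v4; s = v3; ε = v2; q = v1; x = v0 in
               shift · q · x · (ips · m · (snoc · s · x) · ε · (shift · q · x))) in
     ips · v3 · v2 · v1 · v0 ≐
     prefix · c · (ips · v3 · (snoc · v2 · c) · v1 · (shift · v0 · c)))
  ips-equation = ∀I (∀I (∀I (
    let m = v3; s = v2; ε = v1; q = v0
        c = ε · s · ƛ (shift · v1 · v0 · (ips · v4 · (snoc · v3 · v0) · v2 · (shift · v1 · v0)))
        f = choice · m · ε · q · s in
    ips · m · s · ε · q
      ≐⟨ ∀E₃ h0 ε q s ⟩
    unfold · f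
      ≐⟨ ∀E unfold-prefix f ⟩
    prefix · (f · con nil) · (unfold · (advance · f))
      -- `advance` is unfolded to expose its copy of the first entry, so that both copies become `c`
      -- at once.
      ≐⟨ ·-cong ≐I (·-cong ≐I (by-nf refl)) ⟩
    prefix · (f · con nil) · (unfold · ƛ (
      let f = choice · v4 · v2 · v1 · v3 in f · (con cons · (f · con nil) · v0)))
      ≐⟨ ≐-cong (prefix · v0 · (unfold · ƛ (choice · v5 · v3 · v2 · v4 · (con cons · v1 · v0))))
           {u = c} (by-nf refl) ⟩
    prefix · c · (unfold · ƛ (choice · v4 · v2 · v1 · v3 · (con cons · _ · v0)))
      -- The choice after ⟨c⟩ * t for s and q is the choice after t for s * c and q_c. Proving this
      -- for a variable keeps `c` itself out of the normalisation.
      ≐⟨ ·-cong ≐I (·-cong ≐I (∀E (∀I {φ =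
           ƛ (choice · v5 · v3 · v2 · v4 · (con cons · v1 · v0)) ≐
           choice · v4 · v2 · (shift · v1 · v0) · (snoc · v3 · v0)} (by-nf refl)) c)) ⟩
    prefix · c · (unfold · (choice · m · ε · (shift · q · c) · (snoc · s · c)))
      ≐⟨ ·-cong ≐I (≐-sym (∀E₃ h0 ε (shift · q · c) (snoc · s · c))) ⟩
    prefix · c · (ips · m · (snoc · s · c) · ε · (shift · q · c)) ∎)))

theorem5p6 : MBR ≥T[ HAω ⊕ BI ⊕ CONT ] IPS
theorem5p6 i =
  record { X = Block (Types.X i) ; R = Types.R i ; R-discrete = R-discrete } ,
  ips ,
  cut (mbr-respond R-discrete) (cut (unique R-discrete) (cut ips-unfolds ips-equation))
  where open Types i using (R-discrete)
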